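{- Let $a_0,a_1,\alpha,\beta,u,v\in\mathbb{R}$ with $\alpha\beta\neq 0$, $uv\neq 0$ and $|a_0|+|a_1|\neq 0$, and let $(a_{n,k})_{0\le k\le n}$ be the binary binomial interpolated triangle with parameters $(a_0,a_1,\alpha,\beta;u,v)$. Put $\mathcal{A}=u\alpha+2v$ and $\mathcal{B}=u^2\beta-uv\alpha-v^2$. For $n\ge 0$ let $$d_n=\sum_{k=0}^{\lfloor n/2\rfloor}a_{n-k,k}$$ be the sum of the entries of the $n$-th rising diagonal, and for $n\ge 2$ put $D_n=-d_n+\alpha d_{n-1}+\beta d_{n-2}$. Then $$D_n=\mathcal{A}D_{n-2}+\mathcal{B}D_{n-4}\qquad\text{for all } n\ge 6,$$ which is a sixth order linear recurrence relation for the sequence $(d_n)_{n\ge 0}$. Moreover, for every even $n=2k\ge 2$ one has $D_n=-b_k$, where $b_k=a_{k,k}$.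
   Context: The binary binomial interpolated triangle with parameters $(a_0,a_1,\alpha,\beta;u,v)$ is the array of real numbers $a_{n,k}$ ($0\le k\le n$) defined as follows. Its left diagonal is $a_{n,0}=a_n$, where $(a_n)_{n\ge0}$ has initial values $a_0,a_1$ and satisfies $a_n=\alpha a_{n-1}+\beta a_{n-2}$ for $n\ge 2$. The other entries are given by $a_{n,k}=u\,a_{n,k-1}+v\,a_{n-1,k-1}$ for $1\le k\le n$. The sequence $b_n=a_{n,n}$ is called the right diagonal sequence. -}

module Defs where

open import Algebra.Bundles using (CommutativeRing)
open import Data.Fin.Base using (Fin; toℕ)
open import Data.Nat.Base as ℕ using (ℕ; zero; suc; _≤_; _∸_; ⌊_/2⌋)
import Data.Nat.Properties as ℕ
open import Data.Product.Base using (∃-syntax; _×_; _,_)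
open import Data.Rational.Base as ℚ using (ℚ; 0ℚ; 1ℚ; Positive; NonNegative)
import Data.Rational.Properties as ℚ
open import Data.Rational.Solver using (module +-*-Solver)
open import Data.Sum.Base using (inj₁; inj₂)
open import Data.Vec.Functional using (Vector)
open import Function.Base using (_∘_)
open import Level using (0ℓ)
open import Relation.Binary.PropositionalEquality
  using (_≡_; refl; sym; trans; cong; subst)

private
  dist : ℚ → ℚ → ℚ
  dist p q = ℚ.∣ p ℚ.- q ∣

-- Real numbers: Cauchy sequences of rationals, with equality _≈_ meaning
-- that the difference tends to zero.
record ℝ : Set where
  no-eta-equality
  field
    seq    : ℕ → ℚ
    cauchy : ∀ ε → .{{Positive ε}} →
             ∃[ N ] (∀ m n → N ≤ m → N ≤ n → ℚ.∣ seq m ℚ.- seq n ∣ ℚ.≤ ε)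

open ℝ public

infix 4 _≈_

record _≈_ (x y : ℝ) : Set where
  no-eta-equality
  field
    close : ∀ ε → .{{Positive ε}} →
            ∃[ N ] (∀ n → N ≤ n → ℚ.∣ seq x n ℚ.- seq y n ∣ ℚ.≤ ε)

open _≈_ public

private
  open ℚ.≤-Reasoning
  open +-*-Solver

  dist-refl : ∀ p → dist p p ≡ 0ℚ
  dist-refl p = cong ℚ.∣_∣ (ℚ.+-inverseʳ p)

  dist-sym : ∀ p q → dist p q ≡ dist q p
  dist-sym p q = trans (sym (ℚ.∣-p∣≡∣p∣ (p ℚ.- q)))
    (cong ℚ.∣_∣ (solve 2 (λ p q → :- (p :- q) := q :- p) refl p q))

  dist-neg : ∀ p q → dist (ℚ.- p) (ℚ.- q) ≡ dist p q
  dist-neg p q = trans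
    (cong ℚ.∣_∣ (solve 2 (λ p q → (:- p) :- (:- q) := q :- p) refl p q))
    (dist-sym q p)

  dist-triangle : ∀ p q r → dist p r ℚ.≤ dist p q ℚ.+ dist q r
  dist-triangle p q r = begin
    ℚ.∣ p ℚ.- r ∣
      ≡⟨ cong ℚ.∣_∣ (solve 3 (λ p q r → p :- r := (p :- q) :+ (q :- r)) refl p q r) ⟩
    ℚ.∣ (p ℚ.- q) ℚ.+ (q ℚ.- r) ∣
      ≤⟨ ℚ.∣p+q∣≤∣p∣+∣q∣ (p ℚ.- q) (q ℚ.- r) ⟩
    dist p q ℚ.+ dist q r ∎

  dist-+ : ∀ p q r s → dist (p ℚ.+ q) (r ℚ.+ s) ℚ.≤ dist p r ℚ.+ dist q s
  dist-+ p q r s = begin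
    ℚ.∣ (p ℚ.+ q) ℚ.- (r ℚ.+ s) ∣
      ≡⟨ cong ℚ.∣_∣ (solve 4 (λ p q r s →
           (p :+ q) :- (r :+ s) := (p :- r) :+ (q :- s)) refl p q r s) ⟩
    ℚ.∣ (p ℚ.- r) ℚ.+ (q ℚ.- s) ∣
      ≤⟨ ℚ.∣p+q∣≤∣p∣+∣q∣ (p ℚ.- r) (q ℚ.- s) ⟩
    dist p r ℚ.+ dist q s ∎

  *-mono-≤ : ∀ {p q r s} → .{{NonNegative q}} → .{{NonNegative r}} →
             p ℚ.≤ q → r ℚ.≤ s → p ℚ.* r ℚ.≤ q ℚ.* s
  *-mono-≤ {p} {q} {r} {s} p≤q r≤s =
    ℚ.≤-trans (ℚ.*-monoʳ-≤-nonNeg r p≤q) (ℚ.*-monoˡ-≤-nonNeg q r≤s)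

  dist-* : ∀ {B C δ} → .{{Positive B}} → .{{Positive C}} → .{{Positive δ}} →
           ∀ p q r s → ℚ.∣ p ∣ ℚ.≤ B → ℚ.∣ s ∣ ℚ.≤ C →
           dist q s ℚ.≤ δ → dist p r ℚ.≤ δ →
           dist (p ℚ.* q) (r ℚ.* s) ℚ.≤ B ℚ.* δ ℚ.+ C ℚ.* δ
  dist-* {B} {C} {δ} p q r s p≤B s≤C q~s p~r = begin
    ℚ.∣ p ℚ.* q ℚ.- r ℚ.* s ∣
      ≡⟨ cong ℚ.∣_∣ (solve 4 (λ p q r s →
           p :* q :- r :* s := p :* (q :- s) :+ s :* (p :- r)) refl p q r s) ⟩
    ℚ.∣ p ℚ.* (q ℚ.- s) ℚ.+ s ℚ.* (p ℚ.- r) ∣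
      ≤⟨ ℚ.∣p+q∣≤∣p∣+∣q∣ (p ℚ.* (q ℚ.- s)) (s ℚ.* (p ℚ.- r)) ⟩
    ℚ.∣ p ℚ.* (q ℚ.- s) ∣ ℚ.+ ℚ.∣ s ℚ.* (p ℚ.- r) ∣
      ≤⟨ ℚ.+-mono-≤ (bounded p (q ℚ.- s) p≤B q~s) (bounded s (p ℚ.- r) s≤C p~r) ⟩
    B ℚ.* δ ℚ.+ C ℚ.* δ ∎
    where
    bounded : ∀ {D} → .{{Positive D}} → ∀ t e → ℚ.∣ t ∣ ℚ.≤ D → ℚ.∣ e ∣ ℚ.≤ δ →
              ℚ.∣ t ℚ.* e ∣ ℚ.≤ D ℚ.* δ
    bounded {D} t e t≤D e≤δ = begin
      ℚ.∣ t ℚ.* e ∣         ≡⟨ ℚ.∣p*q∣≡∣p∣*∣q∣ t e ⟩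
      ℚ.∣ t ∣ ℚ.* ℚ.∣ e ∣   ≤⟨ *-mono-≤ {{ℚ.pos⇒nonNeg D}} {{ℚ.∣-∣-nonNeg e}} t≤D e≤δ ⟩
      D ℚ.* δ               ∎

  dist-∣∣ : ∀ p q → dist ℚ.∣ p ∣ ℚ.∣ q ∣ ℚ.≤ dist p q
  dist-∣∣ p q with ℚ.∣p∣≡p∨∣p∣≡-p (ℚ.∣ p ∣ ℚ.- ℚ.∣ q ∣)
  ... | inj₁ eq = subst (ℚ._≤ dist p q) (sym eq) (difference p q)
    where
    difference : ∀ p q → ℚ.∣ p ∣ ℚ.- ℚ.∣ q ∣ ℚ.≤ dist p q
    difference p q = begin
      ℚ.∣ p ∣ ℚ.- ℚ.∣ q ∣
        ≡⟨ cong (λ t → ℚ.∣ t ∣ ℚ.- ℚ.∣ q ∣)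
             (solve 2 (λ p q → p := (p :- q) :+ q) refl p q) ⟩
      ℚ.∣ (p ℚ.- q) ℚ.+ q ∣ ℚ.- ℚ.∣ q ∣
        ≤⟨ ℚ.+-monoˡ-≤ (ℚ.- ℚ.∣ q ∣) (ℚ.∣p+q∣≤∣p∣+∣q∣ (p ℚ.- q) q) ⟩
      (dist p q ℚ.+ ℚ.∣ q ∣) ℚ.- ℚ.∣ q ∣
        ≡⟨ solve 2 (λ s t → (s :+ t) :- t := s) refl (dist p q) ℚ.∣ q ∣ ⟩
      dist p q ∎
  ... | inj₂ eq = subst (ℚ._≤ dist p q) (sym eq) (begin
      ℚ.- (ℚ.∣ p ∣ ℚ.- ℚ.∣ q ∣)
        ≡⟨ solve 2 (λ s t → :- (s :- t) := t :- s) refl ℚ.∣ p ∣ ℚ.∣ q ∣ ⟩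
      ℚ.∣ q ∣ ℚ.- ℚ.∣ p ∣
        ≡⟨ cong (λ t → ℚ.∣ t ∣ ℚ.- ℚ.∣ p ∣)
             (solve 2 (λ p q → q := (q :- p) :+ p) refl p q) ⟩
      ℚ.∣ (q ℚ.- p) ℚ.+ p ∣ ℚ.- ℚ.∣ p ∣
        ≤⟨ ℚ.+-monoˡ-≤ (ℚ.- ℚ.∣ p ∣) (ℚ.∣p+q∣≤∣p∣+∣q∣ (q ℚ.- p) p) ⟩
      (dist q p ℚ.+ ℚ.∣ p ∣) ℚ.- ℚ.∣ p ∣
        ≡⟨ solve 2 (λ s t → (s :+ t) :- t := s) refl (dist q p) ℚ.∣ p ∣ ⟩
      dist q p
        ≡⟨ dist-sym q p ⟩
      dist p q ∎)

  share : ∀ B C → .{{Positive B}} → .{{Positive C}} → ∀ ε → .{{Positive ε}} →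
          ∃[ δ ] (Positive δ × B ℚ.* δ ℚ.+ C ℚ.* δ ≡ ε)
  share B C ε = δ , δ-pos , (begin-equality
    B ℚ.* δ ℚ.+ C ℚ.* δ        ≡⟨ ℚ.*-distribʳ-+ δ B C ⟨
    (B ℚ.+ C) ℚ.* (1/S ℚ.* ε)  ≡⟨ ℚ.*-assoc (B ℚ.+ C) 1/S ε ⟨
    ((B ℚ.+ C) ℚ.* 1/S) ℚ.* ε  ≡⟨ cong (ℚ._* ε) (ℚ.*-inverseʳ (B ℚ.+ C) {{S≢0}}) ⟩
    1ℚ ℚ.* ε                   ≡⟨ ℚ.*-identityˡ ε ⟩
    ε                          ∎)
    where
    S-pos = ℚ.pos+pos⇒pos B C
    S≢0   = ℚ.pos⇒nonZero (B ℚ.+ C) {{S-pos}}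
    1/S   = (ℚ.1/ (B ℚ.+ C)) {{S≢0}}
    δ     = 1/S ℚ.* ε
    δ-pos = ℚ.pos*pos⇒pos 1/S {{ℚ.1/pos⇒pos (B ℚ.+ C) {{S-pos}}}} ε

  halve : ∀ ε → .{{Positive ε}} → ∃[ δ ] (Positive δ × δ ℚ.+ δ ≡ ε)
  halve ε =
    let δ , δ-pos , eq = share 1ℚ 1ℚ ε in δ , δ-pos ,
    trans (solve 1 (λ δ → δ :+ δ := con 1ℚ :* δ :+ con 1ℚ :* δ) refl δ) eq

  bound : ∀ x → ∃[ B ] ∃[ N ] (Positive B × (∀ n → N ≤ n → ℚ.∣ seq x n ∣ ℚ.≤ B))
  bound x =
    let N , near = cauchy x 1ℚ in 1ℚ ℚ.+ ℚ.∣ seq x N ∣ , N ,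
    ℚ.pos+nonNeg⇒pos 1ℚ ℚ.∣ seq x N ∣ {{ℚ.∣-∣-nonNeg (seq x N)}} ,
    λ n N≤n → begin
      ℚ.∣ seq x n ∣
        ≡⟨ cong ℚ.∣_∣ (solve 2 (λ p q → p := (p :- q) :+ q) refl (seq x n) (seq x N)) ⟩
      ℚ.∣ (seq x n ℚ.- seq x N) ℚ.+ seq x N ∣
        ≤⟨ ℚ.∣p+q∣≤∣p∣+∣q∣ (seq x n ℚ.- seq x N) (seq x N) ⟩
      dist (seq x n) (seq x N) ℚ.+ ℚ.∣ seq x N ∣
        ≤⟨ ℚ.+-monoˡ-≤ ℚ.∣ seq x N ∣ (near n N N≤n ℕ.≤-refl) ⟩
      1ℚ ℚ.+ ℚ.∣ seq x N ∣ ∎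

  ⊔-≤ˡ : ∀ {m n o} → m ℕ.⊔ n ≤ o → m ≤ o
  ⊔-≤ˡ {m} {n} = ℕ.≤-trans (ℕ.m≤m⊔n m n)

  ⊔-≤ʳ : ∀ {m n o} → m ℕ.⊔ n ≤ o → n ≤ o
  ⊔-≤ʳ {m} {n} = ℕ.≤-trans (ℕ.m≤n⊔m m n)

infixl 6 _+_
infixl 7 _*_
infix  8 -_

constant : ℚ → ℝ
seq    (constant q) _ = q
cauchy (constant q) ε = 0 , λ _ _ _ _ →
  ℚ.≤-trans (ℚ.≤-reflexive (dist-refl q)) (ℚ.<⇒≤ (ℚ.positive⁻¹ ε))

0ℝ 1ℝ : ℝ
0ℝ = constant 0ℚ
1ℝ = constant 1ℚ

_+_ : ℝ → ℝ → ℝ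
seq    (x + y) n = seq x n ℚ.+ seq y n
cauchy (x + y) ε =
  let δ , δ-pos , δ+δ≡ε = halve ε
      M , near-x = cauchy x δ {{δ-pos}}
      N , near-y = cauchy y δ {{δ-pos}}
  in M ℕ.⊔ N , λ m n p q → begin
  dist (seq x m ℚ.+ seq y m) (seq x n ℚ.+ seq y n)
    ≤⟨ dist-+ (seq x m) (seq y m) (seq x n) (seq y n) ⟩
  dist (seq x m) (seq x n) ℚ.+ dist (seq y m) (seq y n)
    ≤⟨ ℚ.+-mono-≤ (near-x m n (⊔-≤ˡ p) (⊔-≤ˡ q)) (near-y m n (⊔-≤ʳ {M} p) (⊔-≤ʳ {M} q)) ⟩
  δ ℚ.+ δ
    ≡⟨ δ+δ≡ε ⟩
  ε ∎

-_ : ℝ → ℝ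
seq    (- x) n = ℚ.- seq x n
cauchy (- x) ε =
  let N , near = cauchy x ε in N , λ m n p q →
  ℚ.≤-trans (ℚ.≤-reflexive (dist-neg (seq x m) (seq x n))) (near m n p q)

_*_ : ℝ → ℝ → ℝ
seq    (x * y) n = seq x n ℚ.* seq y n
cauchy (x * y) ε =
  let B , K , B-pos , x≤B = bound x
      C , L , C-pos , y≤C = bound y
      δ , δ-pos , eq = share B C {{B-pos}} {{C-pos}} ε
      M , near-x = cauchy x δ {{δ-pos}}
      N , near-y = cauchy y δ {{δ-pos}}
  in (K ℕ.⊔ L) ℕ.⊔ (M ℕ.⊔ N) , λ m n p q →
  ℚ.≤-trans
    (dist-* {{B-pos}} {{C-pos}} {{δ-pos}} (seq x m) (seq y m) (seq x n) (seq y n)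
      (x≤B m (⊔-≤ˡ (⊔-≤ˡ p)))
      (y≤C n (⊔-≤ʳ {K} (⊔-≤ˡ q)))
      (near-y m n (⊔-≤ʳ {M} (⊔-≤ʳ {K ℕ.⊔ L} p)) (⊔-≤ʳ {M} (⊔-≤ʳ {K ℕ.⊔ L} q)))
      (near-x m n (⊔-≤ˡ (⊔-≤ʳ {K ℕ.⊔ L} p)) (⊔-≤ˡ (⊔-≤ʳ {K ℕ.⊔ L} q))))
    (ℚ.≤-reflexive eq)

∣_∣ : ℝ → ℝ
seq    ∣ x ∣ n = ℚ.∣ seq x n ∣
cauchy ∣ x ∣ ε =
  let N , near = cauchy x ε in N , λ m n p q →
  ℚ.≤-trans (dist-∣∣ (seq x m) (seq x n)) (near m n p q)

pointwise : ∀ {x y} → (∀ n → seq x n ≡ seq y n) → x ≈ y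
close (pointwise {x} {y} eq) ε = 0 , λ n _ →
  ℚ.≤-trans
    (ℚ.≤-reflexive (trans (cong (λ t → dist t (seq y n)) (eq n)) (dist-refl (seq y n))))
    (ℚ.<⇒≤ (ℚ.positive⁻¹ ε))

≈-refl : ∀ {x} → x ≈ x
≈-refl = pointwise (λ _ → refl)

≈-sym : ∀ {x y} → x ≈ y → y ≈ x
close (≈-sym {x} {y} x≈y) ε =
  let N , near = close x≈y ε in N , λ n p →
  ℚ.≤-trans (ℚ.≤-reflexive (dist-sym (seq y n) (seq x n))) (near n p)

≈-trans : ∀ {x y z} → x ≈ y → y ≈ z → x ≈ z
close (≈-trans {x} {y} {z} x≈y y≈z) ε =
  let δ , δ-pos , δ+δ≡ε = halve ε
      M , near₁ = close x≈y δ {{δ-pos}}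
      N , near₂ = close y≈z δ {{δ-pos}}
  in M ℕ.⊔ N , λ n p → begin
  dist (seq x n) (seq z n)
    ≤⟨ dist-triangle (seq x n) (seq y n) (seq z n) ⟩
  dist (seq x n) (seq y n) ℚ.+ dist (seq y n) (seq z n)
    ≤⟨ ℚ.+-mono-≤ (near₁ n (⊔-≤ˡ p)) (near₂ n (⊔-≤ʳ {M} p)) ⟩
  δ ℚ.+ δ
    ≡⟨ δ+δ≡ε ⟩
  ε ∎

+-cong : ∀ {x y z w} → x ≈ y → z ≈ w → x + z ≈ y + w
close (+-cong {x} {y} {z} {w} x≈y z≈w) ε =
  let δ , δ-pos , δ+δ≡ε = halve ε
      M , near₁ = close x≈y δ {{δ-pos}}
      N , near₂ = close z≈w δ {{δ-pos}}
  in M ℕ.⊔ N , λ n p → begin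
  dist (seq x n ℚ.+ seq z n) (seq y n ℚ.+ seq w n)
    ≤⟨ dist-+ (seq x n) (seq z n) (seq y n) (seq w n) ⟩
  dist (seq x n) (seq y n) ℚ.+ dist (seq z n) (seq w n)
    ≤⟨ ℚ.+-mono-≤ (near₁ n (⊔-≤ˡ p)) (near₂ n (⊔-≤ʳ {M} p)) ⟩
  δ ℚ.+ δ
    ≡⟨ δ+δ≡ε ⟩
  ε ∎

-‿cong : ∀ {x y} → x ≈ y → - x ≈ - y
close (-‿cong {x} {y} x≈y) ε =
  let N , near = close x≈y ε in N , λ n p →
  ℚ.≤-trans (ℚ.≤-reflexive (dist-neg (seq x n) (seq y n))) (near n p)

*-cong : ∀ {x y z w} → x ≈ y → z ≈ w → x * z ≈ y * w
close (*-cong {x} {y} {z} {w} x≈y z≈w) ε =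
  let B , K , B-pos , x≤B = bound x
      C , L , C-pos , w≤C = bound w
      δ , δ-pos , eq = share B C {{B-pos}} {{C-pos}} ε
      M , near₁ = close x≈y δ {{δ-pos}}
      N , near₂ = close z≈w δ {{δ-pos}}
  in (K ℕ.⊔ L) ℕ.⊔ (M ℕ.⊔ N) , λ n p →
  ℚ.≤-trans
    (dist-* {{B-pos}} {{C-pos}} {{δ-pos}} (seq x n) (seq z n) (seq y n) (seq w n)
      (x≤B n (⊔-≤ˡ (⊔-≤ˡ p)))
      (w≤C n (⊔-≤ʳ {K} (⊔-≤ˡ p)))
      (near₂ n (⊔-≤ʳ {M} (⊔-≤ʳ {K ℕ.⊔ L} p)))
      (near₁ n (⊔-≤ˡ (⊔-≤ʳ {K ℕ.⊔ L} p))))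
    (ℚ.≤-reflexive eq)

∣∣-cong : ∀ {x y} → x ≈ y → ∣ x ∣ ≈ ∣ y ∣
close (∣∣-cong {x} {y} x≈y) ε =
  let N , near = close x≈y ε in N , λ n p →
  ℚ.≤-trans (dist-∣∣ (seq x n) (seq y n)) (near n p)

ℝ-commutativeRing : CommutativeRing 0ℓ 0ℓ
ℝ-commutativeRing = record
  { Carrier = ℝ
  ; _≈_     = _≈_
  ; _+_     = _+_
  ; _*_     = _*_
  ; -_      = -_
  ; 0#      = 0ℝ
  ; 1#      = 1ℝ
  ; isCommutativeRing = record
    { isRing = record
      { +-isAbelianGroup = record
        { isGroup = record
          { isMonoid = record
            { isSemigroup = record
              { isMagma = record
                { isEquivalence = record
                  { refl = ≈-refl ; sym = ≈-sym ; trans = ≈-trans }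
                ; ∙-cong = +-cong
                }
              ; assoc = λ x y z → pointwise λ n →
                  ℚ.+-assoc (seq x n) (seq y n) (seq z n)
              }
            ; identity = (λ x → pointwise (ℚ.+-identityˡ ∘ seq x))
                       , (λ x → pointwise (ℚ.+-identityʳ ∘ seq x))
            }
          ; inverse = (λ x → pointwise (ℚ.+-inverseˡ ∘ seq x))
                    , (λ x → pointwise (ℚ.+-inverseʳ ∘ seq x))
          ; ⁻¹-cong = -‿cong
          }
        ; comm = λ x y → pointwise λ n → ℚ.+-comm (seq x n) (seq y n)
        }
      ; *-cong = *-cong
      ; *-assoc = λ x y z → pointwise λ n →
          ℚ.*-assoc (seq x n) (seq y n) (seq z n)
      ; *-identity = (λ x → pointwise (ℚ.*-identityˡ ∘ seq x))
                   , (λ x → pointwise (ℚ.*-identityʳ ∘ seq x))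
      ; distrib = (λ x y z → pointwise λ n →
                     ℚ.*-distribˡ-+ (seq x n) (seq y n) (seq z n))
                , (λ x y z → pointwise λ n →
                     ℚ.*-distribʳ-+ (seq x n) (seq y n) (seq z n))
      }
    ; *-comm = λ x y → pointwise λ n → ℚ.*-comm (seq x n) (seq y n)
    }
  }

open CommutativeRing ℝ-commutativeRing public
  using (_≉_; _-_; +-monoid)

open import Algebra.Properties.Monoid.Sum +-monoid public
  using (sum-syntax; sum⁺-syntax)

-- s n = c₀ s (n-1) + … + c_{k-1} s (n-k) for all n ≥ k.  The order is the
-- number of coefficients; the trailing one is allowed to vanish.
LinearRecurrence : ∀ {k} → Vector ℝ k → (ℕ → ℝ) → Set
LinearRecurrence {k} c s =
  ∀ n → k ≤ n → s n ≈ ∑[ i < k ] (c i * s (n ∸ suc (toℕ i)))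

module BinomialTriangle (a₀ a₁ α β u v : ℝ) where

  left : ℕ → ℝ
  left zero          = a₀
  left (suc zero)    = a₁
  left (suc (suc n)) = α * left (suc n) + β * left n

  -- Only the entries with k ≤ n belong to the triangle; they never depend
  -- on the values filled in for k > n.
  a : ℕ → ℕ → ℝ
  a n       zero    = left n
  a zero    (suc k) = 0ℝ
  a (suc n) (suc k) = u * a (suc n) k + v * a n k

  b : ℕ → ℝ
  b n = a n n

  d : ℕ → ℝ
  d n = ∑[ k ≤ ⌊ n /2⌋ ] a (n ∸ toℕ k) (toℕ k)

  -- Meaningful for n ≥ 2 only, because of the truncated subtraction.
  D : ℕ → ℝ
  D n = - d n + α * d (n ∸ 1) + β * d (n ∸ 2)

  𝓐 𝓑 : ℝ
  𝓐 = u * α + (1ℝ + 1ℝ) * v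
  𝓑 = u * u * β - u * v * α - v * v

{-# OPTIONS --safe #-}
module Submission where

-- Every column satisfies the recurrence of the left diagonal, so in
-- - dₙ + α dₙ₋₁ + β dₙ₋₂ all columns cancel except the last one.  What is left
-- is - aₘ,ₘ for n = 2m and α aₘ,ₘ - aₘ₊₁,ₘ for n = 2m + 1.  Going from m to
-- m + 1, the pair (aₘ,ₘ , aₘ₊₁,ₘ) is multiplied by a fixed 2 × 2 matrix of
-- trace 𝓐 and determinant - 𝓑, and the recurrence for D is its Cayley–Hamilton
-- identity.

open import Defs
open import Algebra.Bundles using (CommutativeRing)
open import Data.Fin.Base using (toℕ; fromℕ; inject₁)
open import Data.Fin.Properties using (toℕ-fromℕ; toℕ-inject₁; toℕ<n)
open import Data.Nat.Base as ℕ using (ℕ; zero; suc; _≤_; _<_; z≤n; s≤s; _∸_; ⌊_/2⌋)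
import Data.Nat.Properties as ℕ
open import Data.Product.Base using (_×_; _,_; ∃-syntax)
open import Data.Rational.Base using (0ℚ; 1ℚ)
open import Data.Rational.Solver using (module +-*-Solver)
open import Data.Sum.Base using (_⊎_; inj₁; inj₂)
open import Data.Vec.Functional using (Vector; _∷_; [])
open import Relation.Binary.PropositionalEquality
  using (_≡_; refl; sym; trans; cong; cong₂; subst; subst₂)

open CommutativeRing ℝ-commutativeRing
  using (setoid; reflexive; +-congˡ; +-congʳ; *-congˡ; semiring; +-commutativeMonoid)
open import Algebra.Properties.Monoid.Sum +-monoid
  using (sum; sum-init-last; sum-cong-≋; sum-cong-≗)
open import Algebra.Properties.CommutativeMonoid.Sum +-commutativeMonoid
  using (∑-distrib-+)
open import Algebra.Properties.Semiring.Sum semiring using (*-distribˡ-sum)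
open import Relation.Binary.Reasoning.Setoid setoid

-- Parity and halving of indices.

even⊎odd : ∀ n → ∃[ m ] (n ≡ m ℕ.* 2 ⊎ n ≡ suc (m ℕ.* 2))
even⊎odd zero          = 0 , inj₁ refl
even⊎odd (suc zero)    = 0 , inj₂ refl
even⊎odd (suc (suc n)) with even⊎odd n
-- Doubling is written `m ℕ.* 2` because `suc m ℕ.* 2` computes to `suc (suc (m ℕ.* 2))`; later
-- index shifts by two then hold by computation.
... | m , inj₁ eq = suc m , inj₁ (cong (λ k → suc (suc k)) eq)
... | m , inj₂ eq = suc m , inj₂ (cong (λ k → suc (suc k)) eq)

⌊m*2/2⌋≡m : ∀ m → ⌊ m ℕ.* 2 /2⌋ ≡ m
⌊m*2/2⌋≡m zero    = refl
⌊m*2/2⌋≡m (suc m) = cong suc (⌊m*2/2⌋≡m m)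

⌊1+m*2/2⌋≡m : ∀ m → ⌊ suc (m ℕ.* 2) /2⌋ ≡ m
⌊1+m*2/2⌋≡m zero    = refl
⌊1+m*2/2⌋≡m (suc m) = cong suc (⌊1+m*2/2⌋≡m m)

m*2≡m+m : ∀ m → m ℕ.* 2 ≡ m ℕ.+ m
m*2≡m+m m = trans (ℕ.*-comm m 2) (cong (m ℕ.+_) (ℕ.+-identityʳ m))

m≤m*2 : ∀ m → m ≤ m ℕ.* 2
m≤m*2 m = ℕ.m≤m*n m 2

m*2∸m≡m : ∀ m → m ℕ.* 2 ∸ m ≡ m
m*2∸m≡m m = trans (cong (_∸ m) (m*2≡m+m m)) (ℕ.m+n∸m≡n m m)

1+m*2∸m≡1+m : ∀ m → suc (m ℕ.* 2) ∸ m ≡ suc m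
1+m*2∸m≡1+m m = trans (ℕ.+-∸-assoc 1 (m≤m*2 m)) (cong suc (m*2∸m≡m m))

-- Recurrences along columns and truncated rising diagonals.

sum-linear : ∀ {k} x y (f g : Vector ℝ k) →
             ∑[ i < k ] (x * f i + y * g i) ≈ x * sum f + y * sum g
sum-linear {k} x y f g = begin
  ∑[ i < k ] (x * f i + y * g i)               ≈⟨ ∑-distrib-+ (λ i → x * f i) (λ i → y * g i) ⟩
  ∑[ i < k ] (x * f i) + ∑[ i < k ] (y * g i)  ≈⟨ +-cong (*-distribˡ-sum x f) (*-distribˡ-sum y g) ⟨
  x * sum f + y * sum g                        ∎

module _ (a₀ a₁ α β u v : ℝ) where
  open BinomialTriangle a₀ a₁ α β u v
  open +-*-Solver

  -- For n = k - 1 the entry a n k is a filler value and the claim fails.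
  column-recurrence : ∀ n k → k ≤ n →
    a (suc (suc n)) k ≈ α * a (suc n) k + β * a n k
  column-recurrence n       zero    _         = ≈-refl
  column-recurrence (suc n) (suc k) (s≤s k≤n) = begin
    u * a (3 ℕ.+ n) k + v * a (2 ℕ.+ n) k
      ≈⟨ +-cong (*-congˡ (column-recurrence (suc n) k (ℕ.m≤n⇒m≤1+n k≤n)))
                (*-congˡ (column-recurrence n k k≤n)) ⟩
    u * (α * a (2 ℕ.+ n) k + β * a (suc n) k) + v * (α * a (suc n) k + β * a n k)
      ≈⟨ regroup (a (2 ℕ.+ n) k) (a (suc n) k) (a n k) ⟩
    α * (u * a (2 ℕ.+ n) k + v * a (suc n) k) + β * (u * a (suc n) k + v * a n k) ∎
    where
    regroup : ∀ x y z → u * (α * x + β * y) + v * (α * y + β * z) ≈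
                        α * (u * x + v * y) + β * (u * y + v * z)
    -- Real operations act termwise on sequences, so a ring identity reduces to the same identity in
    -- ℚ at each index.
    regroup x y z = pointwise λ i → solve 7
      (λ α β u v x y z → u :* (α :* x :+ β :* y) :+ v :* (α :* y :+ β :* z) :=
                         α :* (u :* x :+ v :* y) :+ β :* (u :* y :+ v :* z))
      refl (seq α i) (seq β i) (seq u i) (seq v i) (seq x i) (seq y i) (seq z i)

  -- The number of columns is kept independent of the diagonal, so that three consecutive diagonals
  -- can be cut to the same columns.
  partialSum : ℕ → ℕ → ℝ
  partialSum n m = ∑[ k < m ] a (n ∸ toℕ k) (toℕ k)

  partialSum-last : ∀ n m → partialSum n (suc m) ≈ partialSum n m + a (n ∸ m) m
  partialSum-last n m = begin
    partialSum n (suc m)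
      ≈⟨ sum-init-last entry ⟩
    sum (λ i → entry (inject₁ i)) + entry (fromℕ m)
      ≡⟨ cong₂ _+_ (sum-cong-≗ {m} λ i → cong (λ k → a (n ∸ k) k) (toℕ-inject₁ i))
                   (cong (λ k → a (n ∸ k) k) (toℕ-fromℕ m)) ⟩
    partialSum n m + a (n ∸ m) m ∎
    where
    entry : Vector ℝ (suc m)
    entry i = a (n ∸ toℕ i) (toℕ i)

  -- For `k < m` the bound yields 2k ≤ n, hence k ≤ n - k, so the column recurrence applies to every
  -- summand.
  partialSum-recurrence : ∀ n m → m ℕ.* 2 ≤ 2 ℕ.+ n →
    partialSum (2 ℕ.+ n) m ≈ α * partialSum (1 ℕ.+ n) m + β * partialSum n m
  partialSum-recurrence n m m*2≤2+n = begin
    partialSum (2 ℕ.+ n) m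
      ≈⟨ sum-cong-≋ {m} (λ i → entry (toℕ i) (toℕ<n i)) ⟩
    ∑[ i < m ] (α * a (1 ℕ.+ n ∸ toℕ i) (toℕ i) + β * a (n ∸ toℕ i) (toℕ i))
      ≈⟨ sum-linear {m} α β _ _ ⟩
    α * partialSum (1 ℕ.+ n) m + β * partialSum n m ∎
    where
    entry : ∀ k → k < m →
            a (2 ℕ.+ n ∸ k) k ≈ α * a (1 ℕ.+ n ∸ k) k + β * a (n ∸ k) k
    -- Truncated subtraction of `k` commutes with adding 1 or 2 only because `k ≤ n`.
    entry k k<m = subst₂ (λ p q → a p k ≈ α * a q k + β * a (n ∸ k) k)
      (sym (ℕ.+-∸-assoc 2 k≤n)) (sym (ℕ.+-∸-assoc 1 k≤n))
      (column-recurrence (n ∸ k) k (ℕ.m+n≤o⇒m≤o∸n k k+k≤n))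
      where
      k*2≤n : k ℕ.* 2 ≤ n
      k*2≤n = ℕ.+-cancelˡ-≤ 2 _ _ (ℕ.≤-trans (ℕ.*-monoˡ-≤ 2 k<m) m*2≤2+n)

      k+k≤n : k ℕ.+ k ≤ n
      k+k≤n = subst (_≤ n) (m*2≡m+m k) k*2≤n

      k≤n : k ≤ n
      k≤n = ℕ.≤-trans (m≤m*2 k) k*2≤n

  -- What survives of `D` at even and odd indices.

  d-even : ∀ m → d (m ℕ.* 2) ≈ partialSum (m ℕ.* 2) (suc m)
  d-even m = reflexive (cong (λ h → partialSum (m ℕ.* 2) (suc h)) (⌊m*2/2⌋≡m m))

  d-odd : ∀ m → d (suc (m ℕ.* 2)) ≈ partialSum (suc (m ℕ.* 2)) (suc m)
  d-odd m = reflexive (cong (λ h → partialSum (suc (m ℕ.* 2)) (suc h)) (⌊1+m*2/2⌋≡m m))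

  d-even-last : ∀ m → d (m ℕ.* 2) ≈ partialSum (m ℕ.* 2) m + b m
  d-even-last m = begin
    d (m ℕ.* 2)                                  ≈⟨ d-even m ⟩
    partialSum (m ℕ.* 2) (suc m)                 ≈⟨ partialSum-last (m ℕ.* 2) m ⟩
    partialSum (m ℕ.* 2) m + a (m ℕ.* 2 ∸ m) m
      ≡⟨ cong (λ n → partialSum (m ℕ.* 2) m + a n m) (m*2∸m≡m m) ⟩
    partialSum (m ℕ.* 2) m + b m                 ∎

  d-odd-last : ∀ m → d (suc (m ℕ.* 2)) ≈ partialSum (suc (m ℕ.* 2)) m + a (suc m) m
  d-odd-last m = begin
    d (suc (m ℕ.* 2))
      ≈⟨ d-odd m ⟩
    partialSum (suc (m ℕ.* 2)) (suc m)
      ≈⟨ partialSum-last (suc (m ℕ.* 2)) m ⟩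
    partialSum (suc (m ℕ.* 2)) m + a (suc (m ℕ.* 2) ∸ m) m
      ≡⟨ cong (λ n → partialSum (suc (m ℕ.* 2)) m + a n m) (1+m*2∸m≡1+m m) ⟩
    partialSum (suc (m ℕ.* 2)) m + a (suc m) m ∎

  -- Diagonals 2m and 2m + 1 both have m + 1 columns and diagonal 2m + 2 has one more, whose entry
  -- alone escapes the cancellation.
  D-even : ∀ m → D (suc m ℕ.* 2) ≈ - b (suc m)
  D-even m = begin
    - d (2 ℕ.+ n) + α * d (1 ℕ.+ n) + β * d n
      ≈⟨ +-cong (+-cong (-‿cong (d-even-last (suc m))) (*-congˡ (d-odd m))) (*-congˡ (d-even m)) ⟩
    - (S (2 ℕ.+ n) + b (suc m)) + α * S (1 ℕ.+ n) + β * S n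
      -- The bound on the number of columns is attained: `suc m ℕ.* 2` is `2 ℕ.+ n`.
      ≈⟨ +-congʳ (+-congʳ (-‿cong (+-congʳ (partialSum-recurrence n (suc m) ℕ.≤-refl)))) ⟩
    - (α * S (1 ℕ.+ n) + β * S n + b (suc m)) + α * S (1 ℕ.+ n) + β * S n
      ≈⟨ cancel (S (1 ℕ.+ n)) (S n) (b (suc m)) ⟩
    - b (suc m) ∎
    where
    n = m ℕ.* 2
    S = λ n → partialSum n (suc m)

    cancel : ∀ x y z → - (α * x + β * y + z) + α * x + β * y ≈ - z
    cancel x y z = pointwise λ i → solve 5
      (λ α β x y z → :- (α :* x :+ β :* y :+ z) :+ α :* x :+ β :* y := :- z)
      refl (seq α i) (seq β i) (seq x i) (seq y i) (seq z i)

  -- Diagonals 2m + 3 and 2m + 2 both reach column m + 1, but diagonal 2m + 1 stops at column m, so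
  -- no `β` term is left over.
  D-odd : ∀ m → D (suc (suc m ℕ.* 2)) ≈ α * b (suc m) - a (suc (suc m)) (suc m)
  D-odd m = begin
    - d (2 ℕ.+ n) + α * d (1 ℕ.+ n) + β * d n
      ≈⟨ +-cong (+-cong (-‿cong (d-odd-last (suc m))) (*-congˡ (d-even-last (suc m))))
                (*-congˡ (d-odd m)) ⟩
    - (S (2 ℕ.+ n) + e) + α * (S (1 ℕ.+ n) + b (suc m)) + β * S n
      ≈⟨ +-congʳ (+-congʳ (-‿cong (+-congʳ
           (partialSum-recurrence n (suc m) (ℕ.m≤n⇒m≤1+n ℕ.≤-refl))))) ⟩
    - (α * S (1 ℕ.+ n) + β * S n + e) + α * (S (1 ℕ.+ n) + b (suc m)) + β * S n
      ≈⟨ cancel (S (1 ℕ.+ n)) (S n) e (b (suc m)) ⟩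
    α * b (suc m) - e ∎
    where
    n = suc (m ℕ.* 2)
    S = λ n → partialSum n (suc m)
    e = a (suc (suc m)) (suc m)

    cancel : ∀ x y z w → - (α * x + β * y + z) + α * (x + w) + β * y ≈ α * w - z
    cancel x y z w = pointwise λ i → solve 6
      (λ α β x y z w → :- (α :* x :+ β :* y :+ z) :+ α :* (x :+ w) :+ β :* y := α :* w :- z)
      refl (seq α i) (seq β i) (seq x i) (seq y i) (seq z i) (seq w i)

  -- Cayley-Hamilton for the diagonal and the subdiagonal.

  subdiagonal-step : ∀ m → a (2 ℕ.+ m) (suc m) ≈ u * (α * a (suc m) m + β * b m) + v * a (suc m) m
  -- Column `m` is used from its top entry `b m` on. This is one row of the matrix; the other, for
  -- `b (suc m)`, holds by definition.
  subdiagonal-step m = +-congʳ (*-congˡ (column-recurrence m m ℕ.≤-refl))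

  -- One coordinate of M² = 𝓐 M + 𝓑 I, which is a polynomial identity once all entries are expressed
  -- through `a (suc m) m` and `b m`.
  b-recurrence : ∀ m → b (2 ℕ.+ m) ≈ 𝓐 * b (suc m) + 𝓑 * b m
  b-recurrence m = begin
    u * a (2 ℕ.+ m) (suc m) + v * b (suc m)
      ≈⟨ +-congʳ (*-congˡ (subdiagonal-step m)) ⟩
    u * (u * (α * e + β * b m) + v * e) + v * (u * e + v * b m)
      ≈⟨ cayley-hamilton e (b m) ⟩
    𝓐 * (u * e + v * b m) + 𝓑 * b m ∎
    where
    e = a (suc m) m

    cayley-hamilton : ∀ x y → u * (u * (α * x + β * y) + v * x) + v * (u * x + v * y) ≈
                              𝓐 * (u * x + v * y) + 𝓑 * y
    cayley-hamilton x y = pointwise λ i → solve 6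
      (λ α β u v x y →
        u :* (u :* (α :* x :+ β :* y) :+ v :* x) :+ v :* (u :* x :+ v :* y) :=
        (u :* α :+ (con 1ℚ :+ con 1ℚ) :* v) :* (u :* x :+ v :* y) :+
        (u :* u :* β :- u :* v :* α :- v :* v) :* y)
      refl (seq α i) (seq β i) (seq u i) (seq v i) (seq x i) (seq y i)

  -- The other coordinate of the same matrix identity.
  subdiagonal-recurrence : ∀ m →
    a (3 ℕ.+ m) (2 ℕ.+ m) ≈ 𝓐 * a (2 ℕ.+ m) (suc m) + 𝓑 * a (suc m) m
  subdiagonal-recurrence m = begin
    a (3 ℕ.+ m) (2 ℕ.+ m)
      ≈⟨ subdiagonal-step (suc m) ⟩
    u * (α * e′ + β * (u * e + v * b m)) + v * e′
      -- While `b (suc m)` unfolds by computation, `e′` equals `e″` only up to `_≈_`; it is replaced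
      -- here and restored after the polynomial identity.
      ≈⟨ +-cong (*-congˡ (+-congʳ (*-congˡ step))) (*-congˡ step) ⟩
    u * (α * e″ + β * (u * e + v * b m)) + v * e″
      ≈⟨ cayley-hamilton e (b m) ⟩
    𝓐 * e″ + 𝓑 * e
      ≈⟨ +-congʳ (*-congˡ step) ⟨
    𝓐 * e′ + 𝓑 * e ∎
    where
    e    = a (suc m) m
    e′   = a (2 ℕ.+ m) (suc m)
    e″   = u * (α * e + β * b m) + v * e
    step = subdiagonal-step m

    cayley-hamilton : ∀ x y →
      let z = u * (α * x + β * y) + v * x in
      u * (α * z + β * (u * x + v * y)) + v * z ≈ 𝓐 * z + 𝓑 * x
    cayley-hamilton x y = pointwise λ i → solve 6
      (λ α β u v x y →
        let z = u :* (α :* x :+ β :* y) :+ v :* x in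
        u :* (α :* z :+ β :* (u :* x :+ v :* y)) :+ v :* z :=
        (u :* α :+ (con 1ℚ :+ con 1ℚ) :* v) :* z :+
        (u :* u :* β :- u :* v :* α :- v :* v) :* x)
      refl (seq α i) (seq β i) (seq u i) (seq v i) (seq x i) (seq y i)

  -- The recurrences for `D` and `d`.

  D-recurrence : ∀ n → D (6 ℕ.+ n) ≈ 𝓐 * D (4 ℕ.+ n) + 𝓑 * D (2 ℕ.+ n)
  -- Within one parity class `D` is a fixed linear combination of `b` and the subdiagonal, so it
  -- inherits their common recurrence; one step in `m` is two steps in the index of `D`.
  D-recurrence n with even⊎odd n
  ... | m , inj₁ refl = begin
    D (suc (suc (suc m)) ℕ.* 2)
      ≈⟨ D-even (2 ℕ.+ m) ⟩
    - b (3 ℕ.+ m)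
      ≈⟨ -‿cong (b-recurrence (suc m)) ⟩
    - (𝓐 * b (2 ℕ.+ m) + 𝓑 * b (suc m))
      ≈⟨ distribute 𝓐 𝓑 (b (2 ℕ.+ m)) (b (suc m)) ⟩
    𝓐 * - b (2 ℕ.+ m) + 𝓑 * - b (suc m)
      ≈⟨ +-cong (*-congˡ (D-even (suc m))) (*-congˡ (D-even m)) ⟨
    𝓐 * D (suc (suc m) ℕ.* 2) + 𝓑 * D (suc m ℕ.* 2) ∎
    where
    distribute : ∀ p q x y → - (p * x + q * y) ≈ p * - x + q * - y
    distribute p q x y = pointwise λ i → solve 4
      (λ p q x y → :- (p :* x :+ q :* y) := p :* :- x :+ q :* :- y)
      refl (seq p i) (seq q i) (seq x i) (seq y i)
  ... | m , inj₂ refl = begin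
    D (suc (suc (suc (suc m)) ℕ.* 2))
      ≈⟨ D-odd (2 ℕ.+ m) ⟩
    α * b (3 ℕ.+ m) - e (3 ℕ.+ m)
      ≈⟨ +-cong (*-congˡ (b-recurrence (suc m))) (-‿cong (subdiagonal-recurrence (suc m))) ⟩
    α * (𝓐 * b (2 ℕ.+ m) + 𝓑 * b (suc m)) - (𝓐 * e (2 ℕ.+ m) + 𝓑 * e (suc m))
      ≈⟨ distribute 𝓐 𝓑 (b (2 ℕ.+ m)) (b (suc m)) (e (2 ℕ.+ m)) (e (suc m)) ⟩
    𝓐 * (α * b (2 ℕ.+ m) - e (2 ℕ.+ m)) + 𝓑 * (α * b (suc m) - e (suc m))
      ≈⟨ +-cong (*-congˡ (D-odd (suc m))) (*-congˡ (D-odd m)) ⟨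
    𝓐 * D (suc (suc (suc m) ℕ.* 2)) + 𝓑 * D (suc (suc m ℕ.* 2)) ∎
    where
    e = λ m → a (suc m) m

    distribute : ∀ p q x y z w →
      α * (p * x + q * y) - (p * z + q * w) ≈ p * (α * x - z) + q * (α * y - w)
    distribute p q x y z w = pointwise λ i → solve 7
      (λ α p q x y z w → α :* (p :* x :+ q :* y) :- (p :* z :+ q :* w) :=
                         p :* (α :* x :- z) :+ q :* (α :* y :- w))
      refl (seq α i) (seq p i) (seq q i) (seq x i) (seq y i) (seq z i) (seq w i)

  -- The coefficients are read off from the characteristic polynomial (x² - αx - β)(x⁴ - 𝓐x² - 𝓑).
  d-recurrence : LinearRecurrence
    (α ∷ β + 𝓐 ∷ - (𝓐 * α) ∷ 𝓑 - 𝓐 * β ∷ - (𝓑 * α) ∷ - (𝓑 * β) ∷ []) d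
  d-recurrence (suc (suc (suc (suc (suc (suc n))))))
               (s≤s (s≤s (s≤s (s≤s (s≤s (s≤s z≤n)))))) = begin
    d₆
      -- The definition of `D (6 ℕ.+ n)`, solved for `d₆`.
      ≈⟨ add-back d₆ d₅ d₄ ⟩
    α * d₅ + β * d₄ - D (6 ℕ.+ n)
      ≈⟨ +-congˡ (-‿cong (D-recurrence n)) ⟩
    α * d₅ + β * d₄ - (𝓐 * D (4 ℕ.+ n) + 𝓑 * D (2 ℕ.+ n))
      -- The right-nested form ending in `0ℝ` is what the sum over six indices computes to.
      ≈⟨ expand 𝓐 𝓑 d₅ d₄ d₃ d₂ d₁ d₀ ⟩
    α * d₅ + ((β + 𝓐) * d₄ + (- (𝓐 * α) * d₃ + ((𝓑 - 𝓐 * β) * d₂ +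
      (- (𝓑 * α) * d₁ + (- (𝓑 * β) * d₀ + 0ℝ))))) ∎
    where
    d₀ = d n
    d₁ = d (1 ℕ.+ n)
    d₂ = d (2 ℕ.+ n)
    d₃ = d (3 ℕ.+ n)
    d₄ = d (4 ℕ.+ n)
    d₅ = d (5 ℕ.+ n)
    d₆ = d (6 ℕ.+ n)

    add-back : ∀ x y z → x ≈ α * y + β * z - (- x + α * y + β * z)
    add-back x y z = pointwise λ i → solve 5
      (λ α β x y z → x := α :* y :+ β :* z :- (:- x :+ α :* y :+ β :* z))
      refl (seq α i) (seq β i) (seq x i) (seq y i) (seq z i)

    expand : ∀ p q x₅ x₄ x₃ x₂ x₁ x₀ →
      α * x₅ + β * x₄ - (p * (- x₄ + α * x₃ + β * x₂) + q * (- x₂ + α * x₁ + β * x₀)) ≈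
      α * x₅ + ((β + p) * x₄ + (- (p * α) * x₃ + ((q - p * β) * x₂ +
        (- (q * α) * x₁ + (- (q * β) * x₀ + 0ℝ)))))
    expand p q x₅ x₄ x₃ x₂ x₁ x₀ = pointwise λ i → solve 10
      (λ α β p q x₅ x₄ x₃ x₂ x₁ x₀ →
        α :* x₅ :+ β :* x₄ :- (p :* (:- x₄ :+ α :* x₃ :+ β :* x₂) :+
                               q :* (:- x₂ :+ α :* x₁ :+ β :* x₀)) :=
        α :* x₅ :+ ((β :+ p) :* x₄ :+ (:- (p :* α) :* x₃ :+ ((q :- p :* β) :* x₂ :+
          (:- (q :* α) :* x₁ :+ (:- (q :* β) :* x₀ :+ con 0ℚ))))))
      refl (seq α i) (seq β i) (seq p i) (seq q i) (seq x₅ i) (seq x₄ i) (seq x₃ i)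
           (seq x₂ i) (seq x₁ i) (seq x₀ i)

theorem9 : (a₀ a₁ α β u v : ℝ) →
    α * β ≉ 0ℝ → u * v ≉ 0ℝ → ∣ a₀ ∣ + ∣ a₁ ∣ ≉ 0ℝ →
    let open BinomialTriangle a₀ a₁ α β u v in
    (∀ n → 6 ≤ n → D n ≈ 𝓐 * D (n ∸ 2) + 𝓑 * D (n ∸ 4)) ×
    LinearRecurrence
    (α ∷ β + 𝓐 ∷ - (𝓐 * α) ∷ 𝓑 - 𝓐 * β ∷ - (𝓑 * α) ∷ - (𝓑 * β) ∷ []) d ×
    (∀ n k → n ≡ 2 ℕ.* k → 2 ≤ n → D n ≈ - b k)
theorem9 a₀ a₁ α β u v _ _ _ = recurrence , d-recurrence a₀ a₁ α β u v , even-case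
  where
  open BinomialTriangle a₀ a₁ α β u v

  recurrence : ∀ n → 6 ≤ n → D n ≈ 𝓐 * D (n ∸ 2) + 𝓑 * D (n ∸ 4)
  recurrence (suc (suc (suc (suc (suc (suc n))))))
             (s≤s (s≤s (s≤s (s≤s (s≤s (s≤s z≤n)))))) = D-recurrence a₀ a₁ α β u v n

  even-case : ∀ n k → n ≡ 2 ℕ.* k → 2 ≤ n → D n ≈ - b k
  even-case _ zero    refl ()
  even-case _ (suc k) refl _  =
    -- Passes from `suc k ℕ.* 2`, which unfolds well, to the stated `2 ℕ.* suc k`.
    subst (λ n → D n ≈ - b (suc k)) (ℕ.*-comm (suc k) 2) (D-even a₀ a₁ α β u v k)
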